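{- There is a constant $C>0$ such that for every integer $d \geq 1$ and every $d$-regular graph $G$ on $N$ vertices, $$ i(G) \leq 2^{\frac{N}{2}\left(1+\frac{1}{d}+\frac{C}{d}\sqrt{\frac{\log d}{d}}\right)}. $$
   Context: Graphs are simple, finite and undirected. An independent set of $G$ is a set of vertices no two of which are adjacent; $i(G)$ denotes the number of independent sets of $G$ (including the empty set). Here $\log$ denotes the base-2 logarithm. -}

module Defs where

open import Data.Bool using (Bool; true; false; not; _∧_)
open import Data.Nat as ℕ using (ℕ; zero; suc; _^_; _≤_; _<_)
open import Data.Integer as ℤ using (ℤ; +_; -[1+_]; ∣_∣)
open import Data.Rational as ℚ using (ℚ; ↥_; ↧ₙ_)
open import Data.Fin using (Fin)
open import Data.Vec using (Vec; []; _∷_; lookup)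
open import Data.List using (List; []; _∷_; map; _++_; length; filterᵇ; allFin)
open import Data.Bool.ListAction using (and)
open import Data.Product using (_×_)
open import Data.Sum using (_⊎_)
open import Relation.Binary.PropositionalEquality using (_≡_)

record Graph (N : ℕ) : Set where
  field
    adj     : Fin N → Fin N → Bool
    sym     : ∀ u v → adj u v ≡ adj v u
    irrefl  : ∀ v → adj v v ≡ false
open Graph public

degree : ∀ {N} → Graph N → Fin N → ℕ
degree {N} G v = length (filterᵇ (adj G v) (allFin N))

Regular : ∀ {N} → ℕ → Graph N → Set
Regular d G = ∀ v → degree G v ≡ d

allSubsets : ∀ n → List (Vec Bool n)
allSubsets zero    = [] ∷ []
allSubsets (suc n) = map (true ∷_) (allSubsets n) ++ map (false ∷_) (allSubsets n)

independent : ∀ {N} → Graph N → Vec Bool N → Bool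
independent {N} G S =
  and (map (λ u → and (map (λ v → not (lookup S u ∧ (lookup S v ∧ adj G u v)))
                           (allFin N)))
           (allFin N))

i : ∀ {N} → Graph N → ℕ
i {N} G = length (filterᵇ (independent G) (allSubsets N))

-- Real-free encodings of comparisons with base-2 logarithms / powers.

TwoPowLe : ℤ → ℕ → Set
TwoPowLe (+ k)    m = 2 ^ k ≤ m
TwoPowLe -[1+ k ] m = 1 ≤ m ℕ.* 2 ^ suc k

TwoPowLt : ℤ → ℕ → Set
TwoPowLt (+ k)    m = 2 ^ k < m
TwoPowLt -[1+ k ] m = 1 < m ℕ.* 2 ^ suc k

-- u < log₂ m   (i.e. 2^u < m), for rational u = p/q:  2^p < m^q
LtLog2 : ℚ → ℕ → Set
LtLog2 u m = TwoPowLt (↥ u) (m ^ ↧ₙ u)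

-- w ≤ c · log₂ n   (for c ≥ 0 and n ≥ 1), i.e. 2^w ≤ n^c.
-- With w = a/b, c = e/f this is  2^(a f) ≤ n^(e b).
LeMulLog2 : ℚ → ℚ → ℕ → Set
LeMulLog2 w c n = TwoPowLe (↥ w ℤ.* + (↧ₙ c)) (n ^ (∣ ↥ c ∣ ℕ.* ↧ₙ w))

-- The bound of Theorem 1.2 for given C, d, N and a value I = i(G):
--   I ≤ 2^E,  E = (N/2) (1 + 1/d + (C/d) √(log₂ d / d)).
-- Encoded as: every rational u < log₂ I satisfies u ≤ E, where
--   u ≤ E  ⟺  t ≤ N C √(log₂ d / d)   with t = 2 d u − N (d+1)
--          ⟺  t ≤ 0  or  t² d ≤ (N C)² log₂ d.
-- natural number as a rational
fromℕℚ : ℕ → ℚ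
fromℕℚ n = ℚ._/_ (+ n) 1

BoundAt : ℚ → ℕ → ℕ → ℕ → Set
BoundAt C d N I =
  ∀ (u : ℚ) → LtLog2 u I →
    let t = ℚ._-_ (ℚ._*_ (fromℕℚ (2 ℕ.* d)) u) (fromℕℚ (N ℕ.* (d ℕ.+ 1)))
        NC = ℚ._*_ (fromℕℚ N) C
    in  ℚ._≤_ t ℚ.0ℚ ⊎ LeMulLog2 (ℚ._*_ (ℚ._*_ t t) (fromℕℚ d)) (ℚ._*_ NC NC) d

{-# OPTIONS --safe #-}

-- The term √(log d / d) is not needed: (i G)^2d ≤ 2^((d+1)N), the bound of Kahn and Zhao.
-- By Zhao, (i G)² is at most the number of pairs (A, B) of vertex sets with no edge between A and B:
-- for fixed D = A ⊕ B, let (O, O ⊕ D) be one pair of independent sets; then A ↦ (D ∩ O) ⊕ A injects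
-- the pairs of independent sets with difference D into the pairs without edges in between.
-- For fixed A the sets B contribute ∏ᵥ g_v(A), where g_v(A) is 1 or 2 according as v has a neighbour
-- in A or not. As g_v depends on the neighbourhood of v only and every vertex lies in d neighbourhoods,
-- Finner's inequality gives (∑_A ∏ᵥ g_v(A))^d ≤ ∏ᵥ ∑_{T ⊆ N(v)} g_v(T)^d = (2^d + 2^d − 1)^N.
-- Stating Finner's inequality for an f with f^d ≤ ∏ F_v avoids roots; the induction over
-- coordinates then only needs Mahler's inequality for two terms.
module Submission where

open import Defs hiding (sym)
open import Algebra.Properties.CommutativeMonoid.Sum using ()
open import Data.Bool using (Bool; true; false; not; _∧_; _∨_; _xor_; if_then_else_)
open import Data.Bool.ListAction using (and)
open import Data.Bool.Properties using (xor-comm; ∧-zeroʳ; not-¬)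
open import Data.Empty using (⊥; ⊥-elim)
open import Data.Fin using (Fin; zero; suc)
open import Data.Integer as ℤ using (-[1+_])
import Data.Integer.Properties as ℤ
open import Data.List using ([]; _∷_; map; length; filterᵇ; tabulate; allFin)
open import Data.List.Membership.Propositional using (_∈_)
open import Data.List.Membership.Propositional.Properties using (∈-allFin)
open import Data.List.Properties using (map-++; map-∘)
open import Data.List.Relation.Unary.Any using (here; there)
open import Data.Nat using (ℕ; zero; suc; _+_; _*_; _^_; _≤_; z≤n; s≤s; NonZero; >-nonZero; _<?_)
import Data.Nat as ℕ
open import Data.Nat.ListAction using (sum)
open import Data.Nat.ListAction.Properties using (sum-++)
open import Data.Nat.Properties
open import Data.Nat.Tactic.RingSolver using (solve-∀)
open import Data.Product using (Σ; _×_; _,_)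
open import Data.Rational as ℚ using (ℚ; mkℚ; 0ℚ; 1ℚ; _<_)
import Data.Rational.Properties as ℚ
open import Data.Rational.Unnormalised as ℚᵘ using (mkℚᵘ; *≤*)
import Data.Rational.Unnormalised.Properties as ℚᵘ
open import Data.Sum using (_⊎_; inj₁; inj₂; [_,_]′)
open import Data.Vec using (Vec; []; _∷_; lookup; zipWith)
open import Data.Vec.Properties using (zipWith-comm; lookup-zipWith)
open import Function using (_∘_; id)
open import Relation.Binary.PropositionalEquality using (_≡_; _≗_; refl; sym; trans; cong; cong₂; subst; subst₂)
open import Relation.Nullary using (yes; no)
open Algebra.Properties.CommutativeMonoid.Sum *-1-commutativeMonoid using () renaming (sum to ∏; sum-cong-≗ to ∏-cong)

-- Inequalities for products

^-distribʳ-* : ∀ n a b → (a * b) ^ n ≡ a ^ n * b ^ n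
^-distribʳ-* zero    a b = refl
^-distribʳ-* (suc n) a b =
  trans (cong (a * b *_) (^-distribʳ-* n a b)) ([m*n]*[o*p]≡[m*o]*[n*p] a b (a ^ n) (b ^ n))

^-cancelʳ-≤ : ∀ n .{{_ : NonZero n}} {a b} → a ^ n ≤ b ^ n → a ≤ b
^-cancelʳ-≤ n a^n≤b^n = ≮⇒≥ λ b<a → <⇒≱ (^-monoˡ-< n b<a) a^n≤b^n

2xy≤x²+y² : ∀ x y → 2 * (x * y) ≤ x * x + y * y
2xy≤x²+y² x y = [ ordered x y , reversed ]′ (≤-total x y)
  where
  square : ∀ x k → 2 * (x * (x + k)) + k * k ≡ x * x + (x + k) * (x + k)
  square = solve-∀
  ordered : ∀ x y → x ≤ y → 2 * (x * y) ≤ x * x + y * y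
  ordered x y x≤y with k , refl ← m≤n⇒∃[o]m+o≡n x≤y =
    subst (2 * (x * (x + k)) ≤_) (square x k) (m≤m+n _ _)
  reversed : y ≤ x → 2 * (x * y) ≤ x * x + y * y
  reversed y≤x = subst₂ _≤_ (cong (2 *_) (*-comm y x)) (+-comm (y * y) (x * x)) (ordered y x y≤x)

-- The graph of v ↦ v ^ (n + 1) lies above its tangent at u, with the subtracted term moved across.
tangent : ∀ n u v → suc n * (u ^ n * v) ≤ n * u ^ suc n + v ^ suc n
tangent zero    u v = ≤-reflexive (eq v)
  where
  eq : ∀ v → v + 0 + 0 ≡ v * 1
  eq = solve-∀
-- The induction hypothesis times `v` is added to `suc n * U` times `2xy≤x²+y²`; the terms common to
-- both sides then cancel.
tangent (suc n) u v = +-cancelʳ-≤ (n * (u * U * v) + suc n * (U * (v * v))) _ _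
  (subst₂ _≤_ (lhs n u v U) (rhs n u v U (v ^ suc n))
    (+-mono-≤ (*-monoˡ-≤ v (tangent n u v)) (*-monoʳ-≤ (suc n * U) (2xy≤x²+y² u v))))
  where
  U = u ^ n
  lhs : ∀ n u v U → suc n * (U * v) * v + suc n * U * (2 * (u * v))
      ≡ suc (suc n) * (u * U * v) + (n * (u * U * v) + suc n * (U * (v * v)))
  lhs = solve-∀
  rhs : ∀ n u v U V → (n * (u * U) + V) * v + suc n * U * (u * u + v * v)
      ≡ suc n * (u * (u * U)) + v * V + (n * (u * U * v) + suc n * (U * (v * v)))
  rhs = solve-∀

-- AM-GM for `n` copies of `a / n` and one `b`, denominators cleared: the tangent at `suc n * a`,
-- evaluated at `n * (a + b)`, then divided by `n`, which is why zero is a separate case.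
weighted-am-gm : ∀ n a b → suc n ^ suc n * (a ^ n * b) ≤ n ^ n * (a + b) ^ suc n
weighted-am-gm zero a b = subst₂ _≤_ (sym (eq b)) (eq′ a b) (m≤n+m (b * 1) (a * 1 + 0))
  where
  eq : ∀ b → 1 * (1 * b) ≡ b * 1
  eq = solve-∀
  eq′ : ∀ a b → a * 1 + 0 + b * 1 ≡ 1 * ((a + b) * 1)
  eq′ = solve-∀
weighted-am-gm n@(suc _) a b = *-cancelˡ-≤ n (+-cancelˡ-≤ (n * (suc n * K * (a * A))) _ _
  (subst₂ _≤_ (trans (cong (λ t → suc n * (t * (n * (a + b)))) (^-distribʳ-* n (suc n) a)) (lhs n a b K A))
              (cong₂ _+_ (cong (n *_) (^-distribʳ-* (suc n) (suc n) a))
                         (trans (^-distribʳ-* (suc n) n (a + b)) (*-assoc n (n ^ n) _)))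
     (tangent n (suc n * a) (n * (a + b)))))
  where
  K = suc n ^ n
  A = a ^ n
  lhs : ∀ n a b K A → suc n * (K * A * (n * (a + b)))
      ≡ n * (suc n * K * (a * A)) + n * (suc n * K * (A * b))
  lhs = solve-∀

♯ : ∀ {m} → (Fin m → Bool) → ℕ
♯ {zero}  μ = 0
♯ {suc m} μ = (if μ zero then 1 else 0) + ♯ (μ ∘ suc)

-- ∑ over the b in μ of X b · ∏ (Z c : c ≠ b), that is ∏ Z times the sum of the ratios X b / Z b.
ratioSum : ∀ {m} → (Fin m → Bool) → (X Z : Fin m → ℕ) → ℕ
ratioSum {zero}  μ X Z = 0
ratioSum {suc m} μ X Z =
  ratioSum (μ ∘ suc) (X ∘ suc) (Z ∘ suc) * Z zero + (if μ zero then X zero * ∏ (Z ∘ suc) else 0)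

-- AM-GM for the ratios X b / Z b with b in μ, multiplied by a power of ∏ Z.
ratio-am-gm : ∀ {m} (μ : Fin m → Bool) X Z → (∀ b → μ b ≡ false → X b ≡ Z b) →
  ♯ μ ^ ♯ μ * (∏ X * ∏ Z ^ ♯ μ) ≤ ratioSum μ X Z ^ ♯ μ * ∏ Z
ratio-am-gm {zero}  μ X Z out = ≤-refl
ratio-am-gm {suc m} μ X Z out with μ zero in eq | ratio-am-gm (μ ∘ suc) (X ∘ suc) (Z ∘ suc) (out ∘ suc)
-- Here `X zero` equals `Z zero`, so both sides grow by the same factor `z * z ^ k`.
... | false | ih = subst₂ _≤_
    (trans (lhs (k ^ k) (∏ (X ∘ suc)) z (M ^ k) (z ^ k))
      (cong₂ (λ x t → k ^ k * (x * ∏ (X ∘ suc) * t)) (sym (out zero eq)) (sym (^-distribʳ-* k z M))))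
    (trans (rhs (S ^ k) M z (z ^ k))
      (cong (_* (z * M)) (sym (trans (cong (_^ k) (+-identityʳ (S * z))) (^-distribʳ-* k S z)))))
    (*-monoʳ-≤ (z * z ^ k) ih)
  where
  k = ♯ (μ ∘ suc)
  S = ratioSum (μ ∘ suc) (X ∘ suc) (Z ∘ suc)
  M = ∏ (Z ∘ suc)
  z = Z zero
  lhs : ∀ K P z N y → z * y * (K * (P * N)) ≡ K * (z * P * (y * N))
  lhs = solve-∀
  rhs : ∀ T M z y → z * y * (T * M) ≡ T * y * (z * M)
  rhs = solve-∀
... | true | ih = *-cancelˡ-≤ (k ^ k) {{k^k≢0 k}} (begin
    k ^ k * (suc k ^ suc k * (x * P * (z * M) ^ suc k))
      ≡⟨ cong (λ t → k ^ k * (suc k ^ suc k * (x * P * t))) (^-distribʳ-* (suc k) z M) ⟩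
    k ^ k * (suc k ^ suc k * (x * P * (z ^ suc k * M ^ suc k)))
      ≡⟨ step₁ (k ^ k) (suc k ^ suc k) x P (z ^ suc k) M (M ^ k) ⟩
    suc k ^ suc k * x * z ^ suc k * M * (k ^ k * (P * M ^ k))
      ≤⟨ *-monoʳ-≤ (suc k ^ suc k * x * z ^ suc k * M) ih ⟩
    suc k ^ suc k * x * z ^ suc k * M * (S ^ k * M)
      ≡⟨ step₂ (suc k ^ suc k) x z (z ^ k) M (S ^ k) ⟩
    suc k ^ suc k * (S ^ k * z ^ k * (x * M)) * (z * M)
      ≡⟨ cong (λ t → suc k ^ suc k * (t * (x * M)) * (z * M)) (^-distribʳ-* k S z) ⟨
    suc k ^ suc k * ((S * z) ^ k * (x * M)) * (z * M)
      -- Over the common denominator `z * M` the old ratios have numerator `S * z` and the new one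
      -- has `x * M`.
      ≤⟨ *-monoˡ-≤ (z * M) (weighted-am-gm k (S * z) (x * M)) ⟩
    k ^ k * (S * z + x * M) ^ suc k * (z * M)
      ≡⟨ *-assoc (k ^ k) _ _ ⟩
    k ^ k * ((S * z + x * M) ^ suc k * (z * M)) ∎)
  where
  open ≤-Reasoning
  k = ♯ (μ ∘ suc)
  S = ratioSum (μ ∘ suc) (X ∘ suc) (Z ∘ suc)
  M = ∏ (Z ∘ suc)
  P = ∏ (X ∘ suc)
  z = Z zero
  x = X zero
  -- `0 ^ 0` is 1, so `k ^ k` can be cancelled even when the mask has no further index.
  k^k≢0 : ∀ k → NonZero (k ^ k)
  k^k≢0 zero      = _
  k^k≢0 n@(suc _) = m^n≢0 n n
  step₁ : ∀ K L x P y M N → K * (L * (x * P * (y * (M * N)))) ≡ L * x * y * M * (K * (P * N))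
  step₁ = solve-∀
  step₂ : ∀ L x z y M T → L * x * (z * y) * M * (T * M) ≡ L * (T * y * (x * M)) * (z * M)
  step₂ = solve-∀

-- What summing over one coordinate does to each factor: one that depends on the coordinate adds its
-- two slices, any other keeps its common slice.
merge : ∀ {m} → (Fin m → Bool) → (X Y : Fin m → ℕ) → Fin m → ℕ
merge μ X Y b = if μ b then X b + Y b else Y b

-- For each index in `μ` the two ratios to `merge μ X Y` add up to 1.
ratioSum-merge : ∀ {m} (μ : Fin m → Bool) X Y →
  ratioSum μ X (merge μ X Y) + ratioSum μ Y (merge μ X Y) ≡ ♯ μ * ∏ (merge μ X Y)
ratioSum-merge {zero}  μ X Y = refl
ratioSum-merge {suc m} μ X Y with μ zero | ratioSum-merge (μ ∘ suc) (X ∘ suc) (Y ∘ suc)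
... | false | ih = trans (lhs (ratioSum (μ ∘ suc) (X ∘ suc) Z′) (ratioSum (μ ∘ suc) (Y ∘ suc) Z′) (Y zero))
    (trans (cong (_* Y zero) ih) (rhs (♯ (μ ∘ suc)) (∏ Z′) (Y zero)))
  where
  Z′ = merge (μ ∘ suc) (X ∘ suc) (Y ∘ suc)
  lhs : ∀ s t y → s * y + 0 + (t * y + 0) ≡ (s + t) * y
  lhs = solve-∀
  rhs : ∀ k M y → k * M * y ≡ k * (y * M)
  rhs = solve-∀
... | true  | ih = trans
    (lhs (ratioSum (μ ∘ suc) (X ∘ suc) Z′) (ratioSum (μ ∘ suc) (Y ∘ suc) Z′) (X zero) (Y zero) (∏ Z′))
    (trans (cong (λ t → t * (X zero + Y zero) + (X zero + Y zero) * ∏ Z′) ih)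
           (rhs (♯ (μ ∘ suc)) (∏ Z′) (X zero + Y zero)))
  where
  Z′ = merge (μ ∘ suc) (X ∘ suc) (Y ∘ suc)
  lhs : ∀ s t x y M → s * (x + y) + x * M + (t * (x + y) + y * M) ≡ (s + t) * (x + y) + (x + y) * M
  lhs = solve-∀
  rhs : ∀ k M z → k * M * z + z * M ≡ suc k * (z * M)
  rhs = solve-∀

∏-mono : ∀ {m} {X Y : Fin m → ℕ} → (∀ b → X b ≤ Y b) → ∏ X ≤ ∏ Y
∏-mono {zero}  X≤Y = ≤-refl
∏-mono {suc m} X≤Y = *-mono-≤ (X≤Y zero) (∏-mono (X≤Y ∘ suc))

-- If the claim failed, AM-GM for the ratios X / Z and Y / Z would bound `k * (a * M)` and
-- `k * (b * M)` by `sx * c` and `sy * c`, one of them strictly. The sums of both sides, however,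
-- are equal to `k * M * c`.
mahler : ∀ {m d} (μ : Fin m → Bool) X Y → ♯ μ ≡ suc d → (∀ b → μ b ≡ false → X b ≡ Y b) →
  ∀ a b → a ^ suc d ≤ ∏ X → b ^ suc d ≤ ∏ Y → (a + b) ^ suc d ≤ ∏ (merge μ X Y)
mahler {d = d} μ X Y ♯μ≡k out a b a^k≤X b^k≤Y = ≮⇒≥ absurd
  where
  open ≤-Reasoning
  k = suc d
  Z = merge μ X Y
  M = ∏ Z
  c = a + b
  outX : ∀ b → μ b ≡ false → X b ≡ Z b
  outX b eq rewrite eq = out b eq
  outY : ∀ b → μ b ≡ false → Y b ≡ Z b
  outY b eq rewrite eq = refl
  X≤Z : ∀ b → X b ≤ Z b
  X≤Z b with μ b in eq
  ... | true  = m≤m+n _ _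
  ... | false = ≤-reflexive (out b eq)
  Y≤Z : ∀ b → Y b ≤ Z b
  Y≤Z b with μ b
  ... | true  = m≤n+m _ _
  ... | false = ≤-refl
  sx = ratioSum μ X Z
  sy = ratioSum μ Y Z
  sx+sy≡kM : sx + sy ≡ k * M
  sx+sy≡kM = trans (ratioSum-merge μ X Y) (cong (_* M) ♯μ≡k)

  scaled : ∀ W → (∀ b → μ b ≡ false → W b ≡ Z b) → ∀ a → a ^ k ≤ ∏ W →
    (k * (a * M)) ^ k ≤ ratioSum μ W Z ^ k * M
  scaled W outW a a^k≤W = begin
    (k * (a * M)) ^ k        ≡⟨ trans (^-distribʳ-* k k (a * M)) (cong (k ^ k *_) (^-distribʳ-* k a M)) ⟩
    k ^ k * (a ^ k * M ^ k)  ≤⟨ *-monoʳ-≤ (k ^ k) (*-monoˡ-≤ (M ^ k) a^k≤W) ⟩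
    k ^ k * (∏ W * M ^ k)    ≤⟨ subst (λ n → n ^ n * (∏ W * M ^ n) ≤ ratioSum μ W Z ^ n * M) ♯μ≡k
                                      (ratio-am-gm μ W Z outW) ⟩
    ratioSum μ W Z ^ k * M   ∎

  -- AM-GM involves the `k`-th root of `M`, which need not be an integer. Under this assumption `c`
  -- is a strict upper bound for it.
  module _ (M<c^k : M ℕ.< c ^ k) where
    scaled-≤ : ∀ a s → (k * (a * M)) ^ k ≤ s ^ k * M → k * (a * M) ≤ s * c
    scaled-≤ a s le = ^-cancelʳ-≤ k (begin
      (k * (a * M)) ^ k  ≤⟨ le ⟩
      s ^ k * M          ≤⟨ *-monoʳ-≤ (s ^ k) (<⇒≤ M<c^k) ⟩
      s ^ k * c ^ k      ≡⟨ ^-distribʳ-* k s c ⟨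
      (s * c) ^ k        ∎)

    scaled-< : ∀ a s → 0 ℕ.< s → (k * (a * M)) ^ k ≤ s ^ k * M → k * (a * M) ℕ.< s * c
    scaled-< a s 0<s le = ≰⇒> λ sc≤kaM → <⇒≱ (begin-strict
      (k * (a * M)) ^ k  ≤⟨ le ⟩
      s ^ k * M          <⟨ *-monoʳ-< (s ^ k) {{m^n≢0 s k {{>-nonZero 0<s}}}} M<c^k ⟩
      s ^ k * c ^ k      ≡⟨ ^-distribʳ-* k s c ⟨
      (s * c) ^ k        ∎) (^-monoˡ-≤ k sc≤kaM)

    0<M : 0 ℕ.< M
    0<M = ≰⇒> λ M≤0 → <⇒≱ M<c^k (begin
      c ^ k        ≤⟨ ^-monoˡ-≤ k (+-mono-≤ (vanish a M≤0 (≤-trans a^k≤X (∏-mono X≤Z)))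
                                            (vanish b M≤0 (≤-trans b^k≤Y (∏-mono Y≤Z)))) ⟩
      0            ≤⟨ z≤n ⟩
      M            ∎)
      where
      vanish : ∀ a → M ≤ 0 → a ^ k ≤ M → a ≤ 0
      vanish a M≤0 a^k≤M = ^-cancelʳ-≤ k (≤-trans a^k≤M M≤0)

    -- Since `sx + sy` is `k * M`, hence positive, at least one of the two estimates is strict.
    kaM+kbM<kMc : k * (a * M) + k * (b * M) ℕ.< sx * c + sy * c
    kaM+kbM<kMc with 0 <? sx
    ... | yes 0<sx = +-mono-<-≤ (scaled-< a sx 0<sx (scaled X outX a a^k≤X)) (scaled-≤ b sy (scaled Y outY b b^k≤Y))
    ... | no  0≮sx = +-mono-≤-< (scaled-≤ a sx (scaled X outX a a^k≤X)) (scaled-< b sy 0<sy (scaled Y outY b b^k≤Y))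
      where
      0<sy : 0 ℕ.< sy
      0<sy = begin-strict
        0        <⟨ *-mono-< (s≤s (z≤n {d})) 0<M ⟩
        k * M    ≡⟨ sx+sy≡kM ⟨
        sx + sy  ≤⟨ +-monoˡ-≤ sy (≮⇒≥ 0≮sx) ⟩
        sy       ∎

    absurd : ⊥
    absurd = <-irrefl (trans (eq k a b M) (trans (cong (_* c) (sym sx+sy≡kM)) (*-distribʳ-+ c sx sy))) kaM+kbM<kMc
      where
      eq : ∀ k a b M → k * (a * M) + k * (b * M) ≡ k * M * (a + b)
      eq = solve-∀

∏-one : ∀ {m} (f : Fin m → ℕ) → (∀ b → f b ≡ 1) → ∏ f ≡ 1
∏-one {zero}  f f≡1 = refl
∏-one {suc m} f f≡1 = cong₂ _*_ (f≡1 zero) (∏-one (f ∘ suc) (f≡1 ∘ suc))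

∏-const : ∀ m c → ∏ {m} (λ _ → c) ≡ c ^ m
∏-const zero    c = refl
∏-const (suc m) c = cong (c *_) (∏-const m c)

∏-^ : ∀ {m} n (f : Fin m → ℕ) → ∏ f ^ n ≡ ∏ (λ b → f b ^ n)
∏-^ {zero}  n f = ^-zeroˡ n
∏-^ {suc m} n f = trans (^-distribʳ-* n (f zero) (∏ (f ∘ suc))) (cong (f zero ^ n *_) (∏-^ n (f ∘ suc)))

-- Sums over the subsets of a finite set

∑ : ∀ {n} → (Vec Bool n → ℕ) → ℕ
∑ {zero}  f = f []
∑ {suc n} f = ∑ (f ∘ (true ∷_)) + ∑ (f ∘ (false ∷_))

∑-cong : ∀ {n} {f g : Vec Bool n → ℕ} → f ≗ g → ∑ f ≡ ∑ g
∑-cong {zero}  f≗g = f≗g []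
∑-cong {suc n} f≗g = cong₂ _+_ (∑-cong (f≗g ∘ (true ∷_))) (∑-cong (f≗g ∘ (false ∷_)))

∑-mono : ∀ {n} {f g : Vec Bool n → ℕ} → (∀ x → f x ≤ g x) → ∑ f ≤ ∑ g
∑-mono {zero}  f≤g = f≤g []
∑-mono {suc n} f≤g = +-mono-≤ (∑-mono (f≤g ∘ (true ∷_))) (∑-mono (f≤g ∘ (false ∷_)))

∑-distrib-+ : ∀ {n} (f g : Vec Bool n → ℕ) → ∑ (λ x → f x + g x) ≡ ∑ f + ∑ g
∑-distrib-+ {zero}  f g = refl
∑-distrib-+ {suc n} f g =
  trans (cong₂ _+_ (∑-distrib-+ (f ∘ (true ∷_)) (g ∘ (true ∷_))) (∑-distrib-+ (f ∘ (false ∷_)) (g ∘ (false ∷_))))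
        (exchange (∑ (f ∘ (true ∷_))) (∑ (g ∘ (true ∷_))) (∑ (f ∘ (false ∷_))) (∑ (g ∘ (false ∷_))))
  where
  exchange : ∀ a b c d → (a + b) + (c + d) ≡ (a + c) + (b + d)
  exchange = solve-∀

∑-comm : ∀ {m n} (f : Vec Bool m → Vec Bool n → ℕ) → ∑ (λ x → ∑ (f x)) ≡ ∑ (λ y → ∑ (λ x → f x y))
∑-comm {zero}  f = refl
∑-comm {suc m} f =
  trans (cong₂ _+_ (∑-comm (f ∘ (true ∷_))) (∑-comm (f ∘ (false ∷_))))
        (sym (∑-distrib-+ (λ y → ∑ (λ x → f (true ∷ x) y)) (λ y → ∑ (λ x → f (false ∷ x) y))))

∑-*ˡ : ∀ {n} c (f : Vec Bool n → ℕ) → ∑ (λ x → c * f x) ≡ c * ∑ f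
∑-*ˡ {zero}  c f = refl
∑-*ˡ {suc n} c f = trans (cong₂ _+_ (∑-*ˡ c (f ∘ (true ∷_))) (∑-*ˡ c (f ∘ (false ∷_)))) (sym (*-distribˡ-+ c _ _))

-- Supplies the reference set `O` of a fibre in `zhao`, unless that fibre contributes nothing.
∑-zero-or-positive : ∀ {n} (f : Vec Bool n → ℕ) → ∑ f ≡ 0 ⊎ Σ (Vec Bool n) (λ x → 0 ℕ.< f x)
∑-zero-or-positive {zero}  f with f [] in eq
... | zero  = inj₁ refl
... | suc _ = inj₂ ([] , subst (0 ℕ.<_) (sym eq) (s≤s z≤n))
∑-zero-or-positive {suc n} f with ∑-zero-or-positive (f ∘ (true ∷_)) | ∑-zero-or-positive (f ∘ (false ∷_))
... | inj₂ (x , p) | _            = inj₂ (true ∷ x , p)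
... | inj₁ _       | inj₂ (x , p) = inj₂ (false ∷ x , p)
... | inj₁ p       | inj₁ q       = inj₁ (cong₂ _+_ p q)

infixr 6 _⊕_
_⊕_ : ∀ {n} → Vec Bool n → Vec Bool n → Vec Bool n
_⊕_ = zipWith _xor_

∑-translateˡ : ∀ {n} e (f : Vec Bool n → ℕ) → ∑ (λ x → f (e ⊕ x)) ≡ ∑ f
∑-translateˡ []          f = refl
∑-translateˡ (false ∷ e) f = cong₂ _+_ (∑-translateˡ e (f ∘ (true ∷_))) (∑-translateˡ e (f ∘ (false ∷_)))
∑-translateˡ (true ∷ e)  f =
  trans (cong₂ _+_ (∑-translateˡ e (f ∘ (false ∷_))) (∑-translateˡ e (f ∘ (true ∷_)))) (+-comm (∑ (f ∘ (false ∷_))) _)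

∑-translateʳ : ∀ {n} e (f : Vec Bool n → ℕ) → ∑ (λ x → f (x ⊕ e)) ≡ ∑ f
∑-translateʳ e f = trans (∑-cong (λ x → cong f (zipWith-comm xor-comm x e))) (∑-translateˡ e f)

∑-∏ : ∀ {n} (h : Fin n → Bool → ℕ) → ∑ (λ x → ∏ (λ v → h v (lookup x v))) ≡ ∏ (λ v → h v true + h v false)
∑-∏ {zero}  h = refl
∑-∏ {suc n} h = trans (cong₂ _+_ (factor true) (factor false)) (sym (*-distribʳ-+ _ (h zero true) (h zero false)))
  where
  factor : ∀ b → ∑ (λ x → h zero b * ∏ (λ v → h (suc v) (lookup x v)))
                 ≡ h zero b * ∏ (λ v → h (suc v) true + h (suc v) false)
  factor b = trans (∑-*ˡ (h zero b) (λ x → ∏ (λ v → h (suc v) (lookup x v))))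
                   (cong (h zero b *_) (∑-∏ (h ∘ suc)))

-- The coordinates outside μ are set to false; the summand is meant not to depend on them.
∑[_] : ∀ {n} → (Fin n → Bool) → (Vec Bool n → ℕ) → ℕ
∑[_] {zero}  μ f = f []
∑[_] {suc n} μ f =
  (if μ zero then ∑[ μ ∘ suc ] (f ∘ (true ∷_)) + ∑[ μ ∘ suc ] (f ∘ (false ∷_))
             else ∑[ μ ∘ suc ] (f ∘ (false ∷_)))

∑[]-cong : ∀ {n} (μ : Fin n → Bool) {f g : Vec Bool n → ℕ} → f ≗ g → ∑[ μ ] f ≡ ∑[ μ ] g
∑[]-cong {zero}  μ f≗g = f≗g []
∑[]-cong {suc n} μ f≗g with μ zero
... | true  = cong₂ _+_ (∑[]-cong (μ ∘ suc) (f≗g ∘ (true ∷_))) (∑[]-cong (μ ∘ suc) (f≗g ∘ (false ∷_)))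
... | false = ∑[]-cong (μ ∘ suc) (f≗g ∘ (false ∷_))

-- Finner's inequality

Supported : ∀ {n} → (Fin n → Bool) → (Vec Bool n → ℕ) → Set
Supported μ f = ∀ x y → (∀ v → μ v ≡ true → lookup x v ≡ lookup y v) → f x ≡ f y

-- Each value of the first coordinate gives a smaller instance. Exactly `suc d` factors depend on
-- that coordinate, so `mahler` adds the two instances with the right exponent.
finner : ∀ {n m d} (M : Fin m → Fin n → Bool) → (∀ v → ♯ (λ b → M b v) ≡ suc d) →
  (F : Fin m → Vec Bool n → ℕ) → (∀ b → Supported (M b) (F b)) →
  (f : Vec Bool n → ℕ) → (∀ x → f x ^ suc d ≤ ∏ (λ b → F b x)) →
  ∑ f ^ suc d ≤ ∏ (λ b → ∑[ M b ] (F b))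
finner {zero}  M cover F supp f f≤F = f≤F []
finner {suc n} {m} {d} M cover F supp f f≤F =
  -- The merged slices are `∑[ M b ] (F b)` by definition: both take the false slice outside the
  -- mask.
  mahler (λ b → M b zero) (slice true) (slice false) (cover zero) unmasked
    (∑ (f ∘ (true ∷_))) (∑ (f ∘ (false ∷_))) (ih true) (ih false)
  where
  slice : Bool → Fin m → ℕ
  slice t b = ∑[ M b ∘ suc ] (F b ∘ (t ∷_))
  ih : ∀ t → ∑ (f ∘ (t ∷_)) ^ suc d ≤ ∏ (slice t)
  ih t = finner (λ b → M b ∘ suc) (cover ∘ suc) (λ b → F b ∘ (t ∷_))
    (λ b x y agree → supp b (t ∷ x) (t ∷ y) λ { zero _ → refl ; (suc v) → agree v })
    (f ∘ (t ∷_)) (f≤F ∘ (t ∷_))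
  unmasked : ∀ b → M b zero ≡ false → slice true b ≡ slice false b
  unmasked b out = ∑[]-cong (M b ∘ suc) λ x → supp b (true ∷ x) (false ∷ x)
    λ { zero in-M → ⊥-elim (not-¬ out in-M) ; (suc v) _ → refl }

-- Sums over the subsets of one neighbourhood

meets : ∀ {n} → (Fin n → Bool) → Vec Bool n → Bool
meets μ []      = false
meets μ (t ∷ x) = (μ zero ∧ t) ∨ meets (μ ∘ suc) x

meets-supported : ∀ {n} (μ : Fin n → Bool) x y →
  (∀ v → μ v ≡ true → lookup x v ≡ lookup y v) → meets μ x ≡ meets μ y
meets-supported μ []      []      agree = refl
meets-supported μ (s ∷ x) (t ∷ y) agree =
  cong₂ _∨_ (head (μ zero) (agree zero)) (meets-supported (μ ∘ suc) x y (agree ∘ suc))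
  where
  head : ∀ b → (b ≡ true → s ≡ t) → b ∧ s ≡ b ∧ t
  head true  eq = eq refl
  head false eq = refl

meets-witness : ∀ {n} (μ : Fin n → Bool) x → meets μ x ≡ true → Σ (Fin n) (λ v → μ v ≡ true × lookup x v ≡ true)
meets-witness μ (t ∷ x) eq with μ zero in μ₀ | t
... | true  | true  = zero , μ₀ , refl
... | true  | false = let v , p = meets-witness (μ ∘ suc) x eq in suc v , p
... | false | _     = let v , p = meets-witness (μ ∘ suc) x eq in suc v , p

∑[]-one : ∀ {n} (μ : Fin n → Bool) → ∑[ μ ] (λ _ → 1) ≡ 2 ^ ♯ μ
∑[]-one {zero}  μ = refl
∑[]-one {suc n} μ with μ zero | ∑[]-one (μ ∘ suc)
... | true  | ih = trans (cong₂ _+_ ih ih) (cong (2 ^ ♯ (μ ∘ suc) +_) (sym (+-identityʳ _)))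
... | false | ih = ih

-- Only the empty subset of `μ` fails to meet `μ`. The successor on the left avoids truncated
-- subtraction.
∑[]-meets : ∀ {n} (μ : Fin n → Bool) c → suc (∑[ μ ] (λ x → if meets μ x then 1 else c)) ≡ 2 ^ ♯ μ + c
∑[]-meets {zero}  μ c = refl
∑[]-meets {suc n} μ c with μ zero | ∑[]-meets (μ ∘ suc) c | ∑[]-one (μ ∘ suc)
... | false | ih | _   = ih
... | true  | ih | one = trans (sym (+-suc _ _)) (trans (cong₂ _+_ one ih) (eq (2 ^ ♯ (μ ∘ suc)) c))
  where
  eq : ∀ p c → p + (p + c) ≡ p + (p + 0) + c
  eq = solve-∀

-- Counting independent sets

⟦_⟧ : Bool → ℕ
⟦ b ⟧ = if b then 1 else 0

length-filterᵇ : ∀ {A : Set} (p : A → Bool) xs → length (filterᵇ p xs) ≡ sum (map (⟦_⟧ ∘ p) xs)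
length-filterᵇ p []       = refl
length-filterᵇ p (x ∷ xs) with p x
... | true  = cong suc (length-filterᵇ p xs)
... | false = length-filterᵇ p xs

sum-tabulate : ∀ {A : Set} {n} (f : Fin n → A) (p : A → Bool) → sum (map (⟦_⟧ ∘ p) (tabulate f)) ≡ ♯ (p ∘ f)
sum-tabulate {n = zero}  f p = refl
sum-tabulate {n = suc n} f p = cong (⟦ p (f zero) ⟧ +_) (sum-tabulate (f ∘ suc) p)

degree≡♯ : ∀ {N} (G : Graph N) v → degree G v ≡ ♯ (adj G v)
degree≡♯ G v = trans (length-filterᵇ (adj G v) (allFin _)) (sum-tabulate id (adj G v))

sum-allSubsets : ∀ n (f : Vec Bool n → ℕ) → sum (map f (allSubsets n)) ≡ ∑ f
sum-allSubsets zero    f = +-identityʳ (f [])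
sum-allSubsets (suc n) f = trans (cong sum (map-++ f (map (true ∷_) (allSubsets n)) (map (false ∷_) (allSubsets n))))
  (trans (sum-++ (map f (map (true ∷_) (allSubsets n))) (map f (map (false ∷_) (allSubsets n))))
         (cong₂ _+_ (half true) (half false)))
  where
  half : ∀ t → sum (map f (map (t ∷_) (allSubsets n))) ≡ ∑ (f ∘ (t ∷_))
  half t = trans (cong sum (sym (map-∘ (allSubsets n)))) (sum-allSubsets n (f ∘ (t ∷_)))

i≡∑ : ∀ {N} (G : Graph N) → i G ≡ ∑ (⟦_⟧ ∘ independent G)
i≡∑ {N} G = trans (length-filterᵇ (independent G) (allSubsets N)) (sum-allSubsets N _)

and-map : ∀ {A : Set} (p : A → Bool) {xs x} → x ∈ xs → and (map p xs) ≡ true → p x ≡ true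
and-map p {x ∷ xs} (here refl) eq with p x
... | true = refl
and-map p {y ∷ xs} (there x∈xs) eq with p y
... | true = and-map p x∈xs eq

nonadjacent : ∀ {N} (G : Graph N) S → independent G S ≡ true →
  ∀ u v → adj G u v ≡ true → lookup S u ∧ lookup S v ≡ false
nonadjacent G S ind u v uv
  with lookup S u | lookup S v
     | and-map (λ v → not (lookup S u ∧ (lookup S v ∧ adj G u v))) (∈-allFin v)
         (and-map _ (∈-allFin u) ind)
... | true  | false | _ = refl
... | false | _     | _ = refl
... | true  | true  | p rewrite uv = sym p

-- The indicator that no edge joins a vertex of A to one of B; for the bipartite double cover
-- G × K₂ these pairs are the independent sets.
separated : ∀ {N} → Graph N → Vec Bool N → Vec Bool N → ℕ
separated G A B = ∏ (λ v → if lookup B v ∧ meets (adj G v) A then 0 else 1)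

separated-one : ∀ {N} (G : Graph N) A B →
  (∀ u v → adj G u v ≡ true → lookup A u ∧ lookup B v ≡ false) → separated G A B ≡ 1
separated-one G A B sep = ∏-one (λ v → if lookup B v ∧ meets (adj G v) A then 0 else 1) one
  where
  one : ∀ v → (if lookup B v ∧ meets (adj G v) A then 0 else 1) ≡ 1
  one v with lookup B v in Bv | meets (adj G v) A in mv
  ... | false | _     = refl
  ... | true  | false = refl
  ... | true  | true  with u , vu , Au ← meets-witness (adj G v) A mv
    with () ← trans (sym (cong₂ _∧_ Au Bv)) (sep u v (trans (Graph.sym G u v) vu))

-- Membership of two adjacent vertices u, v in A (a), the reference set O (o) and D = A ⊕ B (d).
-- On D both colourings are proper, so their difference is constant along the edge uv.
swap-separates : ∀ du dv {au av ou ov} →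
  au ∧ av ≡ false → (du xor au) ∧ (dv xor av) ≡ false →
  ou ∧ ov ≡ false → (du xor ou) ∧ (dv xor ov) ≡ false →
  ((du ∧ ou) xor au) ∧ (dv xor ((dv ∧ ov) xor av)) ≡ false
swap-separates false false aa _ _ _ = aa
-- If only v lies in D, then v is in exactly one of A and B, while u is in both or neither.
-- Independence leaves only neither, and the swap does not move u.
swap-separates false true  {true}  {true}  () _ _ _
swap-separates false true  {true}  {false} _ () _ _
swap-separates false true  {false} _ _ _ _ = refl
swap-separates true  false {true}  {true}  () _ _ _
swap-separates true  false {false} {true}  _ () _ _
swap-separates true  false {av = false} _ _ _ _ = ∧-zeroʳ _
swap-separates true true {true}  {false} {true}  {false} _ _ _ _ = refl
swap-separates true true {true}  {false} {false} {true}  _ _ _ _ = refl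
swap-separates true true {false} {true}  {true}  {false} _ _ _ _ = refl
swap-separates true true {false} {true}  {false} {true}  _ _ _ _ = refl

zhao : ∀ {N} (G : Graph N) → i G * i G ≤ ∑ (λ A → ∑ (separated G A))
zhao G = begin
  i G * i G                                  ≡⟨ cong (λ t → t * t) (i≡∑ G) ⟩
  ∑ I * ∑ I                                  ≡⟨ ∑-*ˡ (∑ I) I ⟨
  ∑ (λ A → ∑ I * I A)                        ≡⟨ ∑-cong (λ A → trans (*-comm (∑ I) (I A)) (sym (∑-*ˡ (I A) I))) ⟩
  -- Substituting `D ⊕ A` for `B` groups the pairs by their difference `D`.
  ∑ (λ A → ∑ (λ B → I A * I B))              ≡⟨ ∑-cong (λ A → ∑-translateʳ A (λ B → I A * I B)) ⟨
  ∑ (λ A → ∑ (λ D → I A * I (D ⊕ A)))        ≡⟨ ∑-comm (λ A D → I A * I (D ⊕ A)) ⟩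
  ∑ (λ D → ∑ (λ A → I A * I (D ⊕ A)))        ≤⟨ ∑-mono fibre ⟩
  ∑ (λ D → ∑ (λ A → separated G A (D ⊕ A)))  ≡⟨ ∑-comm (λ D A → separated G A (D ⊕ A)) ⟩
  ∑ (λ A → ∑ (λ D → separated G A (D ⊕ A)))  ≡⟨ ∑-cong (λ A → ∑-translateʳ A (separated G A)) ⟩
  ∑ (λ A → ∑ (separated G A))                ∎
  where
  open ≤-Reasoning
  I : Vec Bool _ → ℕ
  I = ⟦_⟧ ∘ independent G
  swap : ∀ D O → 0 ℕ.< I O * I (D ⊕ O) → ∀ A →
    I A * I (D ⊕ A) ≤ separated G (zipWith _∧_ D O ⊕ A) (D ⊕ (zipWith _∧_ D O ⊕ A))
  swap D O pos A
    with independent G A in indA | independent G (D ⊕ A) in indDA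
       | independent G O in indO | independent G (D ⊕ O) in indDO
  ... | false | _     | _    | _    = z≤n
  ... | true  | false | _    | _    = z≤n
  -- In the omitted cases `O` or `D ⊕ O` is not independent, and `pos` would be a proof of 0 < 0.
  ... | true  | true  | true | true = ≤-reflexive (sym (separated-one G A′ (D ⊕ A′) λ u v uv →
    subst₂ (λ s t → s ∧ t ≡ false)
      (sym (lookup-swapped u))
      (sym (trans (lookup-zipWith _xor_ v D A′) (cong (lookup D v xor_) (lookup-swapped v))))
      (swap-separates (lookup D u) (lookup D v)
        (nonadjacent G A indA u v uv) (shifted A indDA u v uv)
        (nonadjacent G O indO u v uv) (shifted O indDO u v uv))))
    where
    A′ = zipWith _∧_ D O ⊕ A
    lookup-swapped : ∀ u → lookup A′ u ≡ (lookup D u ∧ lookup O u) xor lookup A u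
    lookup-swapped u = trans (lookup-zipWith _xor_ u (zipWith _∧_ D O) A) (cong (_xor lookup A u) (lookup-zipWith _∧_ u D O))
    shifted : ∀ S → independent G (D ⊕ S) ≡ true → ∀ u v → adj G u v ≡ true →
      (lookup D u xor lookup S u) ∧ (lookup D v xor lookup S v) ≡ false
    shifted S ind u v uv = subst₂ (λ s t → s ∧ t ≡ false) (lookup-zipWith _xor_ u D S) (lookup-zipWith _xor_ v D S)
      (nonadjacent G (D ⊕ S) ind u v uv)
  fibre : ∀ D → ∑ (λ A → I A * I (D ⊕ A)) ≤ ∑ (λ A → separated G A (D ⊕ A))
  fibre D with ∑-zero-or-positive (λ A → I A * I (D ⊕ A))
  ... | inj₁ none      = ≤-trans (≤-reflexive none) z≤n
  -- For fixed `D` and `O` the swap is a translation of `A`, so it preserves the sum over all `A`.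
  ... | inj₂ (O , pos) = ≤-trans (∑-mono (swap D O pos))
    (≤-reflexive (∑-translateˡ (zipWith _∧_ D O) (λ A → separated G A (D ⊕ A))))

∑-separated : ∀ {N} (G : Graph N) A → ∑ (separated G A) ≡ ∏ (λ v → if meets (adj G v) A then 1 else 2)
∑-separated G A = trans (∑-∏ (λ v t → if t ∧ meets (adj G v) A then 0 else 1)) (∏-cong λ v → eq (meets (adj G v) A))
  where
  eq : ∀ m → (if m then 0 else 1) + 1 ≡ (if m then 1 else 2)
  eq true  = refl
  eq false = refl

kahn-zhao : ∀ {d N} (G : Graph N) → Regular (suc d) G → (i G * i G) ^ suc d ≤ (2 ^ (suc d + 1)) ^ N
kahn-zhao {d} {N} G reg = begin
  (i G * i G) ^ k                           ≤⟨ ^-monoˡ-≤ k (zhao G) ⟩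
  ∑ (λ A → ∑ (separated G A)) ^ k           ≡⟨ cong (_^ k) (∑-cong (∑-separated G)) ⟩
  -- The masks are the rows of the adjacency matrix, while the cover condition counts columns;
  -- symmetry identifies the two. The `k`-th power turns weight 2 into `2 ^ k`.
  ∑ (λ A → ∏ (λ v → weight 2 v A)) ^ k      ≤⟨ finner (adj G) column (weight (2 ^ k))
                                                      supp (λ A → ∏ (λ v → weight 2 v A)) (λ A → ≤-reflexive (power A)) ⟩
  ∏ (λ v → ∑[ adj G v ] (weight (2 ^ k) v)) ≤⟨ ∏-mono star ⟩
  ∏ {N} (λ v → 2 ^ (k + 1))                 ≡⟨ ∏-const N (2 ^ (k + 1)) ⟩
  (2 ^ (k + 1)) ^ N                         ∎
  where
  open ≤-Reasoning
  k = suc d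
  weight : ℕ → Fin N → Vec Bool N → ℕ
  weight c v A = if meets (adj G v) A then 1 else c
  row : ∀ v → ♯ (adj G v) ≡ k
  row v = trans (sym (degree≡♯ G v)) (reg v)
  ♯-cong : ∀ {m} {μ ν : Fin m → Bool} → μ ≗ ν → ♯ μ ≡ ♯ ν
  ♯-cong {zero}  eq = refl
  ♯-cong {suc m} eq = cong₂ _+_ (cong ⟦_⟧ (eq zero)) (♯-cong (eq ∘ suc))
  column : ∀ v → ♯ (λ u → adj G u v) ≡ k
  column v = trans (♯-cong (λ u → Graph.sym G u v)) (row v)
  supp : ∀ v → Supported (adj G v) (weight (2 ^ k) v)
  supp v x y agree = cong (if_then 1 else 2 ^ k) (meets-supported (adj G v) x y agree)
  power : ∀ A → ∏ (λ v → weight 2 v A) ^ k ≡ ∏ (λ v → weight (2 ^ k) v A)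
  power A = trans (∏-^ k (λ v → weight 2 v A)) (∏-cong λ v → eq (meets (adj G v) A))
    where
    eq : ∀ m → (if m then 1 else 2) ^ k ≡ (if m then 1 else 2 ^ k)
    eq true  = ^-zeroˡ k
    eq false = refl
  star : ∀ v → ∑[ adj G v ] (weight (2 ^ k) v) ≤ 2 ^ (k + 1)
  star v = ≤-trans (n≤1+n (∑[ adj G v ] (weight (2 ^ k) v))) 
    (≤-reflexive (trans (∑[]-meets (adj G v) (2 ^ k))
    (trans (cong (λ n → 2 ^ n + 2 ^ k) (row v))
      (trans (cong (2 ^ k +_) (sym (+-identityʳ (2 ^ k)))) (cong (2 ^_) (+-comm 1 k))))))

-- The logarithmic form of the bound

-- Products in `ℚ` are reduced to lowest terms, so the comparison passes to unnormalised fractions,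
-- where cross-multiplication applies directly.
fromℕℚ-*-≤ : ∀ a b u → ℤ.+ a ℤ.* ℚ.↥ u ℤ.≤ ℤ.+ b ℤ.* ℚ.↧ u → fromℕℚ a ℚ.* u ℚ.≤ fromℕℚ b
fromℕℚ-*-≤ a b u@(mkℚ p q _) ap≤bq = ℚ.toℚᵘ-cancel-≤ (begin
  ℚ.toℚᵘ (fromℕℚ a ℚ.* u)            ≃⟨ ℚ.toℚᵘ-homo-* (fromℕℚ a) u ⟩
  ℚ.toℚᵘ (fromℕℚ a) ℚᵘ.* ℚ.toℚᵘ u    ≃⟨ ℚᵘ.*-congʳ {ℚ.toℚᵘ u} (ℚ.toℚᵘ-fromℚᵘ (mkℚᵘ (ℤ.+ a) 0)) ⟩
  mkℚᵘ (ℤ.+ a) 0 ℚᵘ.* ℚ.toℚᵘ u       ≤⟨ *≤* (subst₂ ℤ._≤_ (sym (ℤ.*-identityʳ (ℤ.+ a ℤ.* p)))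
                                              (cong (λ n → ℤ.+ b ℤ.* ℤ.+ n) (sym (*-identityˡ (suc q)))) ap≤bq) ⟩
  mkℚᵘ (ℤ.+ b) 0                     ≃⟨ ℚ.toℚᵘ-fromℚᵘ (mkℚᵘ (ℤ.+ b) 0) ⟨
  ℚ.toℚᵘ (fromℕℚ b)                  ∎)
  where open ℚᵘ.≤-Reasoning

-- Both hypotheses bound powers of `I`; raised to a common exponent they chain through
-- `I ^ (2 * d * q)`, and powers of 2 are strictly increasing.
exponents : ∀ I d N p q → (I * I) ^ d ≤ (2 ^ (d + 1)) ^ N → 2 ^ p ≤ I ^ q →
  2 * d * p ≤ N * (d + 1) * q
exponents I d N p q bound 2^p≤I^q = ≮⇒≥ λ lt → <⇒≱ (^-monoʳ-< 2 (s≤s (s≤s z≤n)) lt) (begin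
  2 ^ (2 * d * p)              ≡⟨ trans (cong (2 ^_) (*-comm (2 * d) p)) (sym (^-*-assoc 2 p (2 * d))) ⟩
  (2 ^ p) ^ (2 * d)            ≤⟨ ^-monoˡ-≤ (2 * d) 2^p≤I^q ⟩
  (I ^ q) ^ (2 * d)            ≡⟨ trans (^-*-assoc I q (2 * d))
                                     (trans (cong (I ^_) (*-comm q (2 * d))) (sym (^-*-assoc I (2 * d) q))) ⟩
  (I ^ (2 * d)) ^ q            ≡⟨ cong (_^ q) (trans (sym (^-*-assoc I 2 d)) (cong (λ t → (I * t) ^ d) (*-identityʳ I))) ⟩
  ((I * I) ^ d) ^ q            ≤⟨ ^-monoˡ-≤ q bound ⟩
  ((2 ^ (d + 1)) ^ N) ^ q      ≡⟨ trans (cong (_^ q) (^-*-assoc 2 (d + 1) N)) (^-*-assoc 2 ((d + 1) * N) q) ⟩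
  2 ^ ((d + 1) * N * q)        ≡⟨ cong (λ n → 2 ^ (n * q)) (*-comm (d + 1) N) ⟩
  2 ^ (N * (d + 1) * q)        ∎)
  where open ≤-Reasoning

-- Clearing the denominator of `u` reduces `t ≤ 0`, the first alternative of `BoundAt`, to
-- `exponents`.
boundAt : ∀ C d N I → (I * I) ^ d ≤ (2 ^ (d + 1)) ^ N → BoundAt C d N I
boundAt C d N I bound u u<log₂I = inj₁ (begin
  fromℕℚ (2 * d) ℚ.* u ℚ.- E   ≤⟨ ℚ.+-monoˡ-≤ (ℚ.- E)
                                     (fromℕℚ-*-≤ (2 * d) (N * (d + 1)) u (cleared u u<log₂I)) ⟩
  E ℚ.- E                      ≡⟨ ℚ.+-inverseʳ E ⟩
  0ℚ                           ∎)
  where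
  open ℚ.≤-Reasoning
  E = fromℕℚ (N * (d + 1))
  cleared : ∀ u → LtLog2 u I → ℤ.+ (2 * d) ℤ.* ℚ.↥ u ℤ.≤ ℤ.+ (N * (d + 1)) ℤ.* ℚ.↧ u
  cleared (mkℚ (ℤ.+ p) q _) lt = subst₂ ℤ._≤_ (ℤ.pos-* (2 * d) p) (ℤ.pos-* (N * (d + 1)) (suc q))
    (ℤ.+≤+ (exponents I d N p (suc q) bound (<⇒≤ lt)))
  cleared u@(mkℚ -[1+ p ] q _) _ = ℤ.≤-trans
    (ℤ.*-monoˡ-≤-nonNeg (ℤ.+ (2 * d)) {ℚ.↥ u} {ℤ.+ 0} ℤ.-≤+)
    (subst₂ ℤ._≤_ (sym (ℤ.*-zeroʳ (ℤ.+ (2 * d)))) (ℤ.pos-* (N * (d + 1)) (suc q)) (ℤ.+≤+ z≤n))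

theorem1p2 : Σ ℚ (λ C → (0ℚ < C) ×
    ((d N : ℕ) → 1 ≤ d → (G : Graph N) → Regular d G → BoundAt C d N (i G)))
theorem1p2 = 1ℚ , ℚ.*<* (ℤ.+<+ (s≤s z≤n)) , λ
  { (suc d) N _ G reg → boundAt 1ℚ (suc d) N (i G) (kahn-zhao G reg) }
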